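{- Let $d\in\mathbb{N}$ and $\mathbf{s}=(s_1,\dots,s_d)\in\mathbb{N}^d$. If $d$ is even, then $$T_\ast^{\mathcal S}(\overleftarrow{\mathbf{s}})=(-1)^{|\mathbf{s}|}T_\ast^{\mathcal S}(\mathbf{s})\quad\text{and}\quad S_\ast^{\mathcal S}(\overleftarrow{\mathbf{s}})=(-1)^{|\mathbf{s}|}S_\ast^{\mathcal S}(\mathbf{s}).$$ If $d$ is odd, then $$T_\ast^{\mathcal S}(\overleftarrow{\mathbf{s}})=(-1)^{|\mathbf{s}|}S_\ast^{\mathcal S}(\mathbf{s})\quad\text{and}\quad S_\ast^{\mathcal S}(\overleftarrow{\mathbf{s}})=(-1)^{|\mathbf{s}|}T_\ast^{\mathcal S}(\mathbf{s}).$$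
   Context: $\mathbb{N}$ is the set of positive integers; $|\mathbf{s}|=s_1+\cdots+s_d$ and $\overleftarrow{\mathbf{s}}=(s_d,\dots,s_1)$. Stuffle-regularized Euler sums: for $\mathbf{s}\in\mathbb{N}^d$, $\boldsymbol\sigma\in\{\pm1\}^d$, the partial sum $\sum_{n>n_1>\cdots>n_d>0}\prod_{j=1}^d \sigma_j^{n_j}/n_j^{s_j}$ equals $P_{\mathbf{s},\boldsymbol\sigma}(\log n+\gamma)+o(1)$ as $n\to\infty$ for a unique real polynomial $P_{\mathbf{s},\boldsymbol\sigma}$ ($\gamma$ is Euler's constant); put $\zeta_\ast(\mathbf{s};\boldsymbol\sigma)=P_{\mathbf{s},\boldsymbol\sigma}(0)$. (This is the convergent Euler sum when $(s_1,\sigma_1)\ne(1,1)$.) Regularized multiple $T$- and $S$-values: for $\mathbf{s}\in\mathbb{N}^d$, $$T_\ast(\mathbf{s})=\frac1{2^d}\sum_{\sigma_1,\dots,\sigma_d=\pm1}\Big(\prod_{1\le j\le d,\ 2\mid d-j}\sigma_j\Big)\zeta_\ast(\mathbf{s};\boldsymbol\sigma),\qquad S_\ast(\mathbf{s})=\frac1{2^d}\sum_{\sigma_1,\dots,\sigma_d=\pm1}\Big(\prod_{1\le j\le d,\ 2\nmid d-j}\sigma_j\Big)\zeta_\ast(\mathbf{s};\boldsymbol\sigma),$$ with $T_\ast(\emptyset)=S_\ast(\emptyset)=1$. Symmetric values: let $F\in\{T,S\}$ and let $\widetilde F$ be the other one ($\widetilde T=S$, $\widetilde S=T$). For $\mathbf{s}\in\mathbb{N}^d$,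 $$F_\ast^{\mathcal S}(\mathbf{s})=\sum_{i=0}^d(-1)^{s_1+\cdots+s_i}F_\ast(s_i,\dots,s_1)F_\ast(s_{i+1},\dots,s_d)\quad\text{if } d\text{ is even},$$ $$F_\ast^{\mathcal S}(\mathbf{s})=\sum_{i=0}^d(-1)^{s_1+\cdots+s_i}\widetilde F_\ast(s_i,\dots,s_1)F_\ast(s_{i+1},\dots,s_d)\quad\text{if } d\text{ is odd}.$$ -}

module Defs where

open import Level using (0ℓ)
open import Data.Nat as ℕ using (ℕ; zero; suc; NonZero)
import Data.Nat.ListAction as ℕ using (sum)
import Data.Nat.Properties as ℕ
open import Data.Nat.Divisibility using (_∣_; _∣?_)
import Data.Integer as ℤ
import Data.Integer.Properties as ℤ
open import Data.Rational as ℚ using (ℚ; 0ℚ; 1ℚ; ½)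
import Data.Rational.Properties as ℚ
import Data.Rational.Unnormalised as ℚᵘ
import Data.Rational.Unnormalised.Properties as ℚᵘ
open import Data.Rational.Solver using (module +-*-Solver)
open import Data.Sign as Sign using (Sign)
open import Data.Fin using (Fin; toℕ)
open import Data.List as List using (List; []; _∷_; length; take; drop)
open import Data.Vec as Vec using (Vec; []; _∷_; lookup)
import Data.Vec.Functional as Vector
open import Data.Product using (∃-syntax; _×_; _,_; proj₁)
open import Data.Sum using (_⊎_; inj₁; inj₂)
open import Algebra.Bundles using (CommutativeRing; Semiring)
import Algebra.Definitions.RawSemiring as RawSemiring
open import Relation.Nullary.Decidable using (¬?; does)
open import Relation.Unary using (Pred; Decidable)
open import Relation.Binary.PropositionalEquality
  using (_≡_; refl; sym; trans; cong; cong₂; subst; subst₂; module ≡-Reasoning)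
open import Data.Bool using (if_then_else_)

private
  module ℚ^ = RawSemiring ℚ.+-*-rawSemiring

private
  open +-*-Solver using (solve; _:+_; _:*_; _:-_; :-_; _:=_; con)

  ½+½ : ∀ ε → ½ ℚ.* ε ℚ.+ ½ ℚ.* ε ≡ ε
  ½+½ = solve 1 (λ ε → con ½ :* ε :+ con ½ :* ε := ε) refl

  pos-* : ∀ {p q} → 0ℚ ℚ.< p → 0ℚ ℚ.< q → 0ℚ ℚ.< p ℚ.* q
  pos-* {p} {q} p>0 q>0 = ℚ.positive⁻¹ (p ℚ.* q)
    {{ℚ.pos*pos⇒pos p {{ℚ.positive p>0}} q {{ℚ.positive q>0}}}}

  ½ε>0 : ∀ {ε} → 0ℚ ℚ.< ε → 0ℚ ℚ.< ½ ℚ.* ε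
  ½ε>0 = pos-* {½} (ℚ.positive⁻¹ ½)

  *-mono : ∀ {a b c d} → 0ℚ ℚ.≤ c → 0ℚ ℚ.≤ b → a ℚ.≤ b → c ℚ.≤ d →
           a ℚ.* c ℚ.≤ b ℚ.* d
  *-mono {a} {b} {c} {d} 0≤c 0≤b a≤b c≤d = ℚ.≤-trans
    (ℚ.*-monoʳ-≤-nonNeg c {{ℚ.nonNegative 0≤c}} a≤b)
    (ℚ.*-monoˡ-≤-nonNeg b {{ℚ.nonNegative 0≤b}} c≤d)

  -- The distance of products, given bounds on the factors.
  *-close : ∀ {a a′ b b′ A B δ₁ δ₂} →
            ℚ.∣ a ∣ ℚ.≤ A → ℚ.∣ b′ ∣ ℚ.≤ B →
            ℚ.∣ a ℚ.- a′ ∣ ℚ.≤ δ₁ → ℚ.∣ b ℚ.- b′ ∣ ℚ.≤ δ₂ →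
            ℚ.∣ a ℚ.* b ℚ.- a′ ℚ.* b′ ∣ ℚ.≤ A ℚ.* δ₂ ℚ.+ B ℚ.* δ₁
  *-close {a} {a′} {b} {b′} {A} {B} {δ₁} {δ₂} a≤A b′≤B ≤δ₁ ≤δ₂ = begin
    ℚ.∣ a ℚ.* b ℚ.- a′ ℚ.* b′ ∣
      ≡⟨ cong ℚ.∣_∣ (solve 4 (λ a a′ b b′ → a :* b :- a′ :* b′ :=
           a :* (b :- b′) :+ b′ :* (a :- a′)) refl a a′ b b′) ⟩
    ℚ.∣ a ℚ.* (b ℚ.- b′) ℚ.+ b′ ℚ.* (a ℚ.- a′) ∣
      ≤⟨ ℚ.∣p+q∣≤∣p∣+∣q∣ (a ℚ.* (b ℚ.- b′)) (b′ ℚ.* (a ℚ.- a′)) ⟩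
    ℚ.∣ a ℚ.* (b ℚ.- b′) ∣ ℚ.+ ℚ.∣ b′ ℚ.* (a ℚ.- a′) ∣
      ≡⟨ cong₂ ℚ._+_ (ℚ.∣p*q∣≡∣p∣*∣q∣ a (b ℚ.- b′)) (ℚ.∣p*q∣≡∣p∣*∣q∣ b′ (a ℚ.- a′)) ⟩
    ℚ.∣ a ∣ ℚ.* ℚ.∣ b ℚ.- b′ ∣ ℚ.+ ℚ.∣ b′ ∣ ℚ.* ℚ.∣ a ℚ.- a′ ∣
      ≤⟨ ℚ.+-mono-≤
           (*-mono (ℚ.0≤∣p∣ (b ℚ.- b′)) (ℚ.≤-trans (ℚ.0≤∣p∣ a) a≤A) a≤A ≤δ₂)
           (*-mono (ℚ.0≤∣p∣ (a ℚ.- a′)) (ℚ.≤-trans (ℚ.0≤∣p∣ b′) b′≤B) b′≤B ≤δ₁) ⟩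
    A ℚ.* δ₂ ℚ.+ B ℚ.* δ₁ ∎
    where open ℚ.≤-Reasoning

  +-close : ∀ {a a′ b b′ δ₁ δ₂} →
            ℚ.∣ a ℚ.- a′ ∣ ℚ.≤ δ₁ → ℚ.∣ b ℚ.- b′ ∣ ℚ.≤ δ₂ →
            ℚ.∣ (a ℚ.+ b) ℚ.- (a′ ℚ.+ b′) ∣ ℚ.≤ δ₁ ℚ.+ δ₂
  +-close {a} {a′} {b} {b′} {δ₁} {δ₂} ≤δ₁ ≤δ₂ = begin
    ℚ.∣ (a ℚ.+ b) ℚ.- (a′ ℚ.+ b′) ∣
      ≡⟨ cong ℚ.∣_∣ (solve 4 (λ a a′ b b′ →
           (a :+ b) :- (a′ :+ b′) := (a :- a′) :+ (b :- b′)) refl a a′ b b′) ⟩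
    ℚ.∣ (a ℚ.- a′) ℚ.+ (b ℚ.- b′) ∣
      ≤⟨ ℚ.∣p+q∣≤∣p∣+∣q∣ (a ℚ.- a′) (b ℚ.- b′) ⟩
    ℚ.∣ a ℚ.- a′ ∣ ℚ.+ ℚ.∣ b ℚ.- b′ ∣
      ≤⟨ ℚ.+-mono-≤ ≤δ₁ ≤δ₂ ⟩
    δ₁ ℚ.+ δ₂ ∎
    where open ℚ.≤-Reasoning

  dist-sym : ∀ p q → ℚ.∣ p ℚ.- q ∣ ≡ ℚ.∣ q ℚ.- p ∣
  dist-sym p q = trans
    (cong ℚ.∣_∣ (solve 2 (λ p q → p :- q := :- (q :- p)) refl p q))
    (ℚ.∣-p∣≡∣p∣ (q ℚ.- p))

  negate : ∀ p q → ℚ.∣ ℚ.- p ℚ.- ℚ.- q ∣ ≡ ℚ.∣ p ℚ.- q ∣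
  negate p q = trans
    (cong ℚ.∣_∣ (solve 2 (λ p q → :- p :- :- q := :- (p :- q)) refl p q))
    (ℚ.∣-p∣≡∣p∣ (p ℚ.- q))

  ∣∣-close : ∀ a b → ℚ.∣ ℚ.∣ a ∣ ℚ.- ℚ.∣ b ∣ ∣ ℚ.≤ ℚ.∣ a ℚ.- b ∣
  ∣∣-close a b with ℚ.∣p∣≡p∨∣p∣≡-p (ℚ.∣ a ∣ ℚ.- ℚ.∣ b ∣)
  ... | inj₁ eq = subst (ℚ._≤ ℚ.∣ a ℚ.- b ∣) (sym eq) (one a b)
    where
    one : ∀ a b → ℚ.∣ a ∣ ℚ.- ℚ.∣ b ∣ ℚ.≤ ℚ.∣ a ℚ.- b ∣
    one a b = begin
      ℚ.∣ a ∣ ℚ.- ℚ.∣ b ∣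
        ≡⟨ cong (λ p → ℚ.∣ p ∣ ℚ.- ℚ.∣ b ∣) (solve 2 (λ a b → a := (a :- b) :+ b) refl a b) ⟩
      ℚ.∣ (a ℚ.- b) ℚ.+ b ∣ ℚ.- ℚ.∣ b ∣
        ≤⟨ ℚ.+-monoˡ-≤ (ℚ.- ℚ.∣ b ∣) (ℚ.∣p+q∣≤∣p∣+∣q∣ (a ℚ.- b) b) ⟩
      (ℚ.∣ a ℚ.- b ∣ ℚ.+ ℚ.∣ b ∣) ℚ.- ℚ.∣ b ∣
        ≡⟨ solve 2 (λ u v → (u :+ v) :- v := u) refl ℚ.∣ a ℚ.- b ∣ ℚ.∣ b ∣ ⟩
      ℚ.∣ a ℚ.- b ∣ ∎
      where open ℚ.≤-Reasoning
  ... | inj₂ eq = subst (ℚ._≤ ℚ.∣ a ℚ.- b ∣) (sym eq)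
    (begin
      ℚ.- (ℚ.∣ a ∣ ℚ.- ℚ.∣ b ∣)
        ≡⟨ solve 2 (λ u v → :- (u :- v) := v :- u) refl ℚ.∣ a ∣ ℚ.∣ b ∣ ⟩
      ℚ.∣ b ∣ ℚ.- ℚ.∣ a ∣
        ≡⟨ cong (λ p → ℚ.∣ p ∣ ℚ.- ℚ.∣ a ∣) (solve 2 (λ a b → b := (b :- a) :+ a) refl a b) ⟩
      ℚ.∣ (b ℚ.- a) ℚ.+ a ∣ ℚ.- ℚ.∣ a ∣
        ≤⟨ ℚ.+-monoˡ-≤ (ℚ.- ℚ.∣ a ∣) (ℚ.∣p+q∣≤∣p∣+∣q∣ (b ℚ.- a) a) ⟩
      (ℚ.∣ b ℚ.- a ∣ ℚ.+ ℚ.∣ a ∣) ℚ.- ℚ.∣ a ∣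
        ≡⟨ solve 2 (λ u v → (u :+ v) :- v := u) refl ℚ.∣ b ℚ.- a ∣ ℚ.∣ a ∣ ⟩
      ℚ.∣ b ℚ.- a ∣
        ≡⟨ dist-sym b a ⟩
      ℚ.∣ a ℚ.- b ∣ ∎)
    where open ℚ.≤-Reasoning

  0<∣p∣+1 : ∀ p → 0ℚ ℚ.< ℚ.∣ p ∣ ℚ.+ 1ℚ
  0<∣p∣+1 p = ℚ.≤-<-trans (ℚ.0≤∣p∣ p)
    (subst (ℚ._< ℚ.∣ p ∣ ℚ.+ 1ℚ) (ℚ.+-identityʳ ℚ.∣ p ∣)
      (ℚ.+-monoʳ-< ℚ.∣ p ∣ (ℚ.positive⁻¹ 1ℚ)))

  -- Splits ε > 0 into shares that survive multiplication by A, B > 0.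
  share : ∀ {A ε} → 0ℚ ℚ.< A → 0ℚ ℚ.< ε →
          ∃[ δ ] (0ℚ ℚ.< δ × A ℚ.* δ ≡ ½ ℚ.* ε)
  share {A} {ε} A>0 ε>0 = 1/A ℚ.* (½ ℚ.* ε) , pos-* 1/A>0 (½ε>0 ε>0) , (begin
      A ℚ.* (1/A ℚ.* (½ ℚ.* ε))  ≡⟨ ℚ.*-assoc A 1/A (½ ℚ.* ε) ⟨
      (A ℚ.* 1/A) ℚ.* (½ ℚ.* ε)  ≡⟨ cong (ℚ._* (½ ℚ.* ε)) (ℚ.*-inverseʳ A {{A≢0}}) ⟩
      1ℚ ℚ.* (½ ℚ.* ε)           ≡⟨ ℚ.*-identityˡ (½ ℚ.* ε) ⟩
      ½ ℚ.* ε                    ∎)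
    where
    open ≡-Reasoning
    A≢0 : ℚ.NonZero A
    A≢0 = ℚ.>-nonZero A>0
    1/A : ℚ
    1/A = (ℚ.1/ A) {{A≢0}}
    1/A>0 : 0ℚ ℚ.< 1/A
    1/A>0 = ℚ.positive⁻¹ 1/A {{ℚ.1/pos⇒pos A {{ℚ.positive A>0}}}}

  -- n / (m + 1) → 0 as m → ∞.
  archimedean : ∀ n {ε} → 0ℚ ℚ.< ε → ∃[ N ] (∀ m → N ℕ.≤ m →
                (ℤ.+ n ℚ./ 1) ℚ.* (ℤ.+ 1 ℚ./ suc m) ℚ.≤ ε)
  archimedean n {ε@(ℚ.mkℚ ℤ.+[1+ a ] b-1 _)} _ = n ℕ.* suc b-1 , λ m N≤m →
    ℚ.toℚᵘ-cancel-≤ (ℚᵘ.≤-trans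
      (ℚᵘ.≤-reflexive (ℚᵘ.≃-trans
        (ℚ.toℚᵘ-homo-* (ℤ.+ n ℚ./ 1) (ℤ.+ 1 ℚ./ suc m))
        (ℚᵘ.*-cong (ℚ.toℚᵘ-fromℚᵘ (ℚᵘ.mkℚᵘ (ℤ.+ n) 0))
                   (ℚ.toℚᵘ-fromℚᵘ (ℚᵘ.mkℚᵘ (ℤ.+ 1) m)))))
      (ℚᵘ.*≤* (subst₂ ℤ._≤_
        (trans (ℤ.pos-* n (suc b-1)) (cong (ℤ._* ℤ.+ suc b-1) (sym (ℤ.*-identityʳ (ℤ.+ n)))))
        (trans (ℤ.pos-* (suc a) (suc m))
               (cong (λ k → ℤ.+ suc a ℤ.* ℤ.+ suc k) (sym (ℕ.+-identityʳ m))))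
        (ℤ.+≤+ (ℕ.≤-trans N≤m (ℕ.≤-trans (ℕ.n≤1+n m) (ℕ.m≤m+n (suc m) (a ℕ.* suc m))))))))
  archimedean n {ℚ.mkℚ ℤ.+0 b-1 _} (ℚ.*<* (ℤ.+<+ ()))
  archimedean n {ℚ.mkℚ ℤ.-[1+ a ] b-1 _} (ℚ.*<* ())

-- Cauchy sequences of rationals, identified by _≃_.
record ℝ : Set where
  no-eta-equality
  field
    seq    : ℕ → ℚ
    cauchy : ∀ ε → 0ℚ ℚ.< ε →
             ∃[ N ] (∀ m n → N ℕ.≤ m → N ℕ.≤ n → ℚ.∣ seq m ℚ.- seq n ∣ ℚ.≤ ε)
open ℝ public

infix 4 _≃_ _≤_

record _≃_ (x y : ℝ) : Set where
  constructor mk≃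
  field
    close : ∀ ε → 0ℚ ℚ.< ε →
            ∃[ N ] (∀ n → N ℕ.≤ n → ℚ.∣ seq x n ℚ.- seq y n ∣ ℚ.≤ ε)
open _≃_ public

record _≤_ (x y : ℝ) : Set where
  constructor mk≤
  field
    below : ∀ ε → 0ℚ ℚ.< ε →
            ∃[ N ] (∀ n → N ℕ.≤ n → seq x n ℚ.≤ seq y n ℚ.+ ε)
open _≤_ public

private
  left : ∀ {m n o} → m ℕ.⊔ n ℕ.≤ o → m ℕ.≤ o
  left {m} {n} = ℕ.≤-trans (ℕ.m≤m⊔n m n)

  right : ∀ {m n o} → m ℕ.⊔ n ℕ.≤ o → n ℕ.≤ o
  right {m} {n} = ℕ.≤-trans (ℕ.m≤n⊔m m n)

  bounded : ∀ x → ∃[ B ] (0ℚ ℚ.< B × ∃[ N ] (∀ n → N ℕ.≤ n → ℚ.∣ seq x n ∣ ℚ.≤ B))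
  bounded x with cauchy x 1ℚ (ℚ.positive⁻¹ 1ℚ)
  ... | N , c = ℚ.∣ a ∣ ℚ.+ 1ℚ , 0<∣p∣+1 a , N , bound
    where
    a : ℚ
    a = seq x N
    open ℚ.≤-Reasoning
    bound : ∀ n → N ℕ.≤ n → ℚ.∣ seq x n ∣ ℚ.≤ ℚ.∣ a ∣ ℚ.+ 1ℚ
    bound n N≤n = begin
      ℚ.∣ seq x n ∣
        ≡⟨ cong ℚ.∣_∣ (solve 2 (λ p a → p := a :+ (p :- a)) refl (seq x n) a) ⟩
      ℚ.∣ a ℚ.+ (seq x n ℚ.- a) ∣
        ≤⟨ ℚ.∣p+q∣≤∣p∣+∣q∣ a (seq x n ℚ.- a) ⟩
      ℚ.∣ a ∣ ℚ.+ ℚ.∣ seq x n ℚ.- a ∣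
        ≤⟨ ℚ.+-monoʳ-≤ ℚ.∣ a ∣ (c n N N≤n ℕ.≤-refl) ⟩
      ℚ.∣ a ∣ ℚ.+ 1ℚ ∎

fromℚ : ℚ → ℝ
seq (fromℚ q) _ = q
cauchy (fromℚ q) ε ε>0 = 0 , λ _ _ _ _ →
  subst (ℚ._≤ ε) (sym (cong ℚ.∣_∣ (ℚ.+-inverseʳ q))) (ℚ.<⇒≤ ε>0)

infixl 6 _+_ _-_
infixl 7 _*_
infix 8 -_

_+_ : ℝ → ℝ → ℝ
seq (x + y) n = seq x n ℚ.+ seq y n
cauchy (x + y) ε ε>0 =
  let N₁ , c₁ = cauchy x (½ ℚ.* ε) (½ε>0 ε>0)
      N₂ , c₂ = cauchy y (½ ℚ.* ε) (½ε>0 ε>0)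
  in N₁ ℕ.⊔ N₂ , λ m n m≥ n≥ →
     subst (ℚ.∣ (seq x m ℚ.+ seq y m) ℚ.- (seq x n ℚ.+ seq y n) ∣ ℚ.≤_) (½+½ ε)
       (+-close {seq x m} (c₁ m n (left m≥) (left n≥)) (c₂ m n (right {N₁} m≥) (right {N₁} n≥)))

-_ : ℝ → ℝ
seq (- x) n = ℚ.- seq x n
cauchy (- x) ε ε>0 =
  let N , c = cauchy x ε ε>0
  in N , λ m n m≥ n≥ → subst (ℚ._≤ ε) (sym (negate (seq x m) (seq x n))) (c m n m≥ n≥)

_-_ : ℝ → ℝ → ℝ
x - y = x + (- y)

∣_∣ : ℝ → ℝ
seq (∣ x ∣) n = ℚ.∣ seq x n ∣
cauchy (∣ x ∣) ε ε>0 =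
  let N , c = cauchy x ε ε>0
  in N , λ m n m≥ n≥ → ℚ.≤-trans (∣∣-close (seq x m) (seq x n)) (c m n m≥ n≥)

_*_ : ℝ → ℝ → ℝ
seq (x * y) n = seq x n ℚ.* seq y n
cauchy (x * y) ε ε>0 =
  let A , A>0 , M₁ , a = bounded x
      B , B>0 , M₂ , b = bounded y
      δ₂ , δ₂>0 , Aδ₂ = share A>0 ε>0
      δ₁ , δ₁>0 , Bδ₁ = share B>0 ε>0
      N₁ , c₁ = cauchy x δ₁ δ₁>0
      N₂ , c₂ = cauchy y δ₂ δ₂>0
  in (M₁ ℕ.⊔ M₂) ℕ.⊔ (N₁ ℕ.⊔ N₂) , λ m n m≥ n≥ →
     subst (ℚ.∣ seq x m ℚ.* seq y m ℚ.- seq x n ℚ.* seq y n ∣ ℚ.≤_)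
       (trans (cong₂ ℚ._+_ Aδ₂ Bδ₁) (½+½ ε))
       (*-close {seq x m} {seq x n}
         (a m (left (left m≥)))
         (b n (right {M₁} (left n≥)))
         (c₁ m n (left (right {M₁ ℕ.⊔ M₂} m≥)) (left (right {M₁ ℕ.⊔ M₂} n≥)))
         (c₂ m n (right {N₁} (right {M₁ ℕ.⊔ M₂} m≥)) (right {N₁} (right {M₁ ℕ.⊔ M₂} n≥))))

0ℝ 1ℝ : ℝ
0ℝ = fromℚ 0ℚ
1ℝ = fromℚ 1ℚ

private
  pointwise : ∀ {x y} → (∀ n → seq x n ≡ seq y n) → x ≃ y
  pointwise {x} {y} eq = mk≃ λ ε ε>0 → 0 , λ n _ →
    subst (ℚ._≤ ε)
      (sym (cong ℚ.∣_∣ (trans (cong (ℚ._- seq y n) (eq n)) (ℚ.+-inverseʳ (seq y n)))))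
      (ℚ.<⇒≤ ε>0)

  ≃-refl : ∀ {x} → x ≃ x
  ≃-refl = pointwise (λ _ → refl)

  ≃-sym : ∀ {x y} → x ≃ y → y ≃ x
  ≃-sym {x} {y} x≃y = mk≃ λ ε ε>0 →
    let N , c = close x≃y ε ε>0
    in N , λ n n≥ → subst (ℚ._≤ ε) (dist-sym (seq x n) (seq y n)) (c n n≥)

  ≃-trans : ∀ {x y z} → x ≃ y → y ≃ z → x ≃ z
  ≃-trans {x} {y} {z} x≃y y≃z = mk≃ λ ε ε>0 →
    let N₁ , c₁ = close x≃y (½ ℚ.* ε) (½ε>0 ε>0)
        N₂ , c₂ = close y≃z (½ ℚ.* ε) (½ε>0 ε>0)
    in N₁ ℕ.⊔ N₂ , λ n n≥ →
       subst₂ ℚ._≤_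
         (cong ℚ.∣_∣ (solve 3 (λ p q r → (p :+ q) :- (q :+ r) := p :- r) refl
                       (seq x n) (seq y n) (seq z n)))
         (½+½ ε)
         (+-close {seq x n} {seq y n} (c₁ n (left n≥)) (c₂ n (right {N₁} n≥)))

  +-cong : ∀ {x x′ y y′} → x ≃ x′ → y ≃ y′ → x + y ≃ x′ + y′
  +-cong {x} {x′} {y} {y′} x≃x′ y≃y′ = mk≃ λ ε ε>0 →
    let N₁ , c₁ = close x≃x′ (½ ℚ.* ε) (½ε>0 ε>0)
        N₂ , c₂ = close y≃y′ (½ ℚ.* ε) (½ε>0 ε>0)
    in N₁ ℕ.⊔ N₂ , λ n n≥ →
       subst (ℚ.∣ (seq x n ℚ.+ seq y n) ℚ.- (seq x′ n ℚ.+ seq y′ n) ∣ ℚ.≤_) (½+½ ε)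
         (+-close {seq x n} (c₁ n (left n≥)) (c₂ n (right {N₁} n≥)))

  -‿cong : ∀ {x y} → x ≃ y → - x ≃ - y
  -‿cong {x} {y} x≃y = mk≃ λ ε ε>0 →
    let N , c = close x≃y ε ε>0
    in N , λ n n≥ →
       subst (ℚ._≤ ε) (sym (negate (seq x n) (seq y n))) (c n n≥)

  *-cong : ∀ {x x′ y y′} → x ≃ x′ → y ≃ y′ → x * y ≃ x′ * y′
  *-cong {x} {x′} {y} {y′} x≃x′ y≃y′ = mk≃ λ ε ε>0 →
    let A , A>0 , M₁ , a = bounded x
        B , B>0 , M₂ , b = bounded y′
        δ₂ , δ₂>0 , Aδ₂ = share A>0 ε>0
        δ₁ , δ₁>0 , Bδ₁ = share B>0 ε>0
        N₁ , c₁ = close x≃x′ δ₁ δ₁>0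
        N₂ , c₂ = close y≃y′ δ₂ δ₂>0
    in (M₁ ℕ.⊔ M₂) ℕ.⊔ (N₁ ℕ.⊔ N₂) , λ n n≥ →
       subst (ℚ.∣ seq x n ℚ.* seq y n ℚ.- seq x′ n ℚ.* seq y′ n ∣ ℚ.≤_)
         (trans (cong₂ ℚ._+_ Aδ₂ Bδ₁) (½+½ ε))
         (*-close {seq x n} {seq x′ n}
           (a n (left (left n≥)))
           (b n (right {M₁} (left n≥)))
           (c₁ n (left (right {M₁ ℕ.⊔ M₂} n≥)))
           (c₂ n (right {N₁} (right {M₁ ℕ.⊔ M₂} n≥))))

ℝ-commutativeRing : CommutativeRing 0ℓ 0ℓ
ℝ-commutativeRing = record
  { Carrier = ℝ
  ; _≈_ = _≃_
  ; _+_ = _+_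
  ; _*_ = _*_
  ; -_ = -_
  ; 0# = 0ℝ
  ; 1# = 1ℝ
  ; isCommutativeRing = record
    { isRing = record
      { +-isAbelianGroup = record
        { isGroup = record
          { isMonoid = record
            { isSemigroup = record
              { isMagma = record
                { isEquivalence = record { refl = ≃-refl ; sym = ≃-sym ; trans = ≃-trans }
                ; ∙-cong = +-cong
                }
              ; assoc = λ x y z → pointwise (λ n → ℚ.+-assoc (seq x n) (seq y n) (seq z n))
              }
            ; identity = (λ x → pointwise (λ n → ℚ.+-identityˡ (seq x n)))
                       , (λ x → pointwise (λ n → ℚ.+-identityʳ (seq x n)))
            }
          ; inverse = (λ x → pointwise (λ n → ℚ.+-inverseˡ (seq x n)))
                    , (λ x → pointwise (λ n → ℚ.+-inverseʳ (seq x n)))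
          ; ⁻¹-cong = -‿cong
          }
        ; comm = λ x y → pointwise (λ n → ℚ.+-comm (seq x n) (seq y n))
        }
      ; *-cong = *-cong
      ; *-assoc = λ x y z → pointwise (λ n → ℚ.*-assoc (seq x n) (seq y n) (seq z n))
      ; *-identity = (λ x → pointwise (λ n → ℚ.*-identityˡ (seq x n)))
                   , (λ x → pointwise (λ n → ℚ.*-identityʳ (seq x n)))
      ; distrib = (λ x y z → pointwise (λ n → ℚ.*-distribˡ-+ (seq x n) (seq y n) (seq z n)))
                , (λ x y z → pointwise (λ n → ℚ.*-distribʳ-+ (seq x n) (seq y n) (seq z n)))
      }
    ; *-comm = λ x y → pointwise (λ n → ℚ.*-comm (seq x n) (seq y n))
    }
  }

open RawSemiring (Semiring.rawSemiring (CommutativeRing.semiring ℝ-commutativeRing)) public using (_^_; sum)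

infix 4 _⟶_

_⟶_ : (ℕ → ℝ) → ℝ → Set
x ⟶ l = ∀ ε → 0ℚ ℚ.< ε → ∃[ N ] (∀ n → N ℕ.≤ n → ∣ x n - l ∣ ≤ fromℚ ε)

∑< : ℕ → (ℕ → ℚ) → ℚ
∑< zero    f = 0ℚ
∑< (suc n) f = ∑< n f ℚ.+ f n

1/1+_ : ℕ → ℚ
1/1+ j = ℤ.+ 1 ℚ./ suc j

private
  logTerm : ℚ → ℕ → ℚ
  logTerm q j = (q ℚ^.^ suc j) ℚ.* (1/1+ j)

  module Log (k : ℕ) where
    n q : ℚ
    n = ℤ.+ suc k ℚ./ 1
    q = 1ℚ ℚ.- (1/1+ k)

    x : ℕ → ℚ
    x N = ∑< N (logTerm q)

    1/1+≥0 : ∀ j → 0ℚ ℚ.≤ 1/1+ j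
    1/1+≥0 j = ℚ.nonNegative⁻¹ (1/1+ j) {{ℚ.normalize-nonNeg 1 (suc j)}}

    n≥0 : 0ℚ ℚ.≤ n
    n≥0 = ℚ.nonNegative⁻¹ n {{ℚ.normalize-nonNeg (suc k) 1}}

    1/1+-anti : ∀ {i j} → i ℕ.≤ j → 1/1+ j ℚ.≤ 1/1+ i
    1/1+-anti {i} {j} i≤j = ℚ.toℚᵘ-cancel-≤ (ℚᵘ.≤-trans
      (ℚᵘ.≤-reflexive (ℚ.toℚᵘ-fromℚᵘ (ℚᵘ.mkℚᵘ (ℤ.+ 1) j)))
      (ℚᵘ.≤-trans
        (ℚᵘ.*≤* (ℤ.+≤+ (ℕ.+-monoˡ-≤ 0 (ℕ.s≤s i≤j))))
        (ℚᵘ.≤-reflexive (ℚᵘ.≃-sym (ℚ.toℚᵘ-fromℚᵘ (ℚᵘ.mkℚᵘ (ℤ.+ 1) i))))))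

    n*1/n : n ℚ.* (1/1+ k) ≡ 1ℚ
    n*1/n = ℚ.toℚᵘ-injective (ℚᵘ.≃-trans
      (ℚ.toℚᵘ-homo-* n (1/1+ k))
      (ℚᵘ.≃-trans
        (ℚᵘ.*-cong (ℚ.toℚᵘ-fromℚᵘ (ℚᵘ.mkℚᵘ (ℤ.+ suc k) 0))
                   (ℚ.toℚᵘ-fromℚᵘ (ℚᵘ.mkℚᵘ (ℤ.+ 1) k)))
        (ℚᵘ.*≡* (cong (ℤ.+_) (ones k)))))
      where
      ones : ∀ k → suc k ℕ.* 1 ℕ.* 1 ≡ 1 ℕ.* (1 ℕ.* suc k)
      ones k = trans (trans (ℕ.*-identityʳ _) (ℕ.*-identityʳ _))
                     (sym (trans (ℕ.*-identityˡ _) (ℕ.*-identityˡ _)))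

    q≥0 : 0ℚ ℚ.≤ q
    q≥0 = subst (ℚ._≤ q) (ℚ.+-inverseʳ (1/1+ k))
      (ℚ.+-monoˡ-≤ (ℚ.- (1/1+ k)) (1/1+-anti {0} {k} ℕ.z≤n))

    q≤1 : q ℚ.≤ 1ℚ
    q≤1 = subst (q ℚ.≤_) (ℚ.+-identityʳ 1ℚ)
      (ℚ.+-monoʳ-≤ 1ℚ (ℚ.neg-antimono-≤ (1/1+≥0 k)))

    q^≥0 : ∀ j → 0ℚ ℚ.≤ q ℚ^.^ j
    q^≥0 zero    = ℚ.nonNegative⁻¹ 1ℚ
    q^≥0 (suc j) = subst (ℚ._≤ q ℚ.* (q ℚ^.^ j)) (ℚ.*-zeroˡ 0ℚ)
      (*-mono ℚ.≤-refl q≥0 q≥0 (q^≥0 j))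

    q^≤1 : ∀ j → q ℚ^.^ j ℚ.≤ 1ℚ
    q^≤1 zero    = ℚ.≤-refl
    q^≤1 (suc j) = subst (q ℚ.* (q ℚ^.^ j) ℚ.≤_) (ℚ.*-identityˡ 1ℚ)
      (*-mono (q^≥0 j) (ℚ.nonNegative⁻¹ 1ℚ) q≤1 (q^≤1 j))

    term≥0 : ∀ j → 0ℚ ℚ.≤ logTerm q j
    term≥0 j = subst (ℚ._≤ logTerm q j) (ℚ.*-zeroˡ 0ℚ)
      (*-mono ℚ.≤-refl (q^≥0 (suc j)) (q^≥0 (suc j)) (1/1+≥0 j))

    -- q^(j+1) ≤ q^j = n (q^j - q^(j+1)).
    geometric : ∀ j → q ℚ^.^ suc j ℚ.≤ n ℚ.* (q ℚ^.^ j ℚ.- q ℚ^.^ suc j)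
    geometric j = begin
      q ℚ.* p
        ≤⟨ *-mono (q^≥0 j) (ℚ.nonNegative⁻¹ 1ℚ) q≤1 ℚ.≤-refl ⟩
      1ℚ ℚ.* p
        ≡⟨ cong (ℚ._* p) (sym n*1/n) ⟩
      (n ℚ.* (1/1+ k)) ℚ.* p
        ≡⟨ solve 3 (λ n r p → (n :* r) :* p := n :* (p :- (con 1ℚ :- r) :* p)) refl n (1/1+ k) p ⟩
      n ℚ.* (p ℚ.- q ℚ.* p) ∎
      where
      open ℚ.≤-Reasoning
      p : ℚ
      p = q ℚ^.^ j

    increasing : ∀ m i → x m ℚ.≤ x (i ℕ.+ m)
    increasing m zero    = ℚ.≤-refl
    increasing m (suc i) = ℚ.≤-trans (increasing m i)
      (subst (ℚ._≤ x (i ℕ.+ m) ℚ.+ logTerm q (i ℕ.+ m)) (ℚ.+-identityʳ _)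
        (ℚ.+-monoʳ-≤ (x (i ℕ.+ m)) (term≥0 (i ℕ.+ m))))

    tail : ∀ m i → let c = n ℚ.* (1/1+ m) in
           x (i ℕ.+ m) ℚ.+ c ℚ.* (q ℚ^.^ (i ℕ.+ m)) ℚ.≤ x m ℚ.+ c ℚ.* (q ℚ^.^ m)
    tail m zero    = ℚ.≤-refl
    tail m (suc i) = begin
      (X ℚ.+ P′ ℚ.* (1/1+ M)) ℚ.+ (n ℚ.* r) ℚ.* P′
        ≤⟨ ℚ.+-monoˡ-≤ ((n ℚ.* r) ℚ.* P′) (ℚ.+-monoʳ-≤ X
             (*-mono (1/1+≥0 M) nD≥0 (geometric M) (1/1+-anti (ℕ.m≤n+m m i)))) ⟩
      (X ℚ.+ (n ℚ.* (P ℚ.- P′)) ℚ.* r) ℚ.+ (n ℚ.* r) ℚ.* P′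
        ≡⟨ solve 5 (λ X n P P′ r → (X :+ (n :* (P :- P′)) :* r) :+ (n :* r) :* P′ :=
             X :+ (n :* r) :* P) refl X n P P′ r ⟩
      X ℚ.+ (n ℚ.* r) ℚ.* P
        ≤⟨ tail m i ⟩
      x m ℚ.+ (n ℚ.* r) ℚ.* (q ℚ^.^ m) ∎
      where
      open ℚ.≤-Reasoning
      M : ℕ
      M = i ℕ.+ m
      X P P′ r : ℚ
      X = x M
      P = q ℚ^.^ M
      P′ = q ℚ^.^ suc M
      r = 1/1+ m
      nD≥0 : 0ℚ ℚ.≤ n ℚ.* (P ℚ.- P′)
      nD≥0 = ℚ.≤-trans (q^≥0 (suc M)) (geometric M)

    step : ∀ m i → ℚ.∣ x (i ℕ.+ m) ℚ.- x m ∣ ℚ.≤ n ℚ.* (1/1+ m)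
    step m i = begin
      ℚ.∣ X ℚ.- x m ∣
        ≡⟨ ℚ.0≤p⇒∣p∣≡p (subst (ℚ._≤ X ℚ.- x m) (ℚ.+-inverseʳ (x m))
             (ℚ.+-monoˡ-≤ (ℚ.- x m) (increasing m i))) ⟩
      X ℚ.- x m
        ≤⟨ ℚ.+-monoˡ-≤ (ℚ.- x m) (begin
             X                              ≡⟨ ℚ.+-identityʳ X ⟨
             X ℚ.+ 0ℚ                       ≤⟨ ℚ.+-monoʳ-≤ X (c*≥0 (i ℕ.+ m)) ⟩
             X ℚ.+ c ℚ.* (q ℚ^.^ (i ℕ.+ m)) ≤⟨ tail m i ⟩
             x m ℚ.+ c ℚ.* (q ℚ^.^ m)
               ≤⟨ ℚ.+-monoʳ-≤ (x m) (*-mono (q^≥0 m) c≥0 ℚ.≤-refl (q^≤1 m)) ⟩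
             x m ℚ.+ c ℚ.* 1ℚ               ∎) ⟩
      (x m ℚ.+ c ℚ.* 1ℚ) ℚ.- x m
        ≡⟨ solve 2 (λ a c → (a :+ c :* con 1ℚ) :- a := c) refl (x m) c ⟩
      c ∎
      where
      open ℚ.≤-Reasoning
      X c : ℚ
      X = x (i ℕ.+ m)
      c = n ℚ.* (1/1+ m)
      c≥0 : 0ℚ ℚ.≤ c
      c≥0 = subst (ℚ._≤ c) (ℚ.*-zeroˡ 0ℚ) (*-mono ℚ.≤-refl n≥0 n≥0 (1/1+≥0 m))
      c*≥0 : ∀ j → 0ℚ ℚ.≤ c ℚ.* (q ℚ^.^ j)
      c*≥0 j = subst (ℚ._≤ c ℚ.* (q ℚ^.^ j)) (ℚ.*-zeroˡ 0ℚ) (*-mono ℚ.≤-refl c≥0 c≥0 (q^≥0 j))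

    step-≤ : ∀ {m o} → m ℕ.≤ o → ℚ.∣ x o ℚ.- x m ∣ ℚ.≤ n ℚ.* (1/1+ m)
    step-≤ {m} {o} m≤o = subst (λ j → ℚ.∣ x j ℚ.- x m ∣ ℚ.≤ n ℚ.* (1/1+ m))
      (ℕ.m∸n+n≡m m≤o) (step m (o ℕ.∸ m))

    x-cauchy : ∀ ε → 0ℚ ℚ.< ε →
               ∃[ N ] (∀ m o → N ℕ.≤ m → N ℕ.≤ o → ℚ.∣ x m ℚ.- x o ∣ ℚ.≤ ε)
    x-cauchy ε ε>0 with archimedean (suc k) ε>0
    ... | N , small = N , λ m o m≥ o≥ → case m o m≥ o≥ (ℕ.≤-total m o)
      where
      case : ∀ m o → N ℕ.≤ m → N ℕ.≤ o → m ℕ.≤ o ⊎ o ℕ.≤ m → ℚ.∣ x m ℚ.- x o ∣ ℚ.≤ ε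
      case m o m≥ _ (inj₁ m≤o) = subst (ℚ._≤ ε) (dist-sym (x o) (x m))
        (ℚ.≤-trans (step-≤ m≤o) (small m m≥))
      case m o _ o≥ (inj₂ o≤m) = ℚ.≤-trans (step-≤ o≤m) (small o o≥)

-- Mercator's series: log (k + 1) = - log (1 - q) = ∑ qʲ / j over j ≥ 1,
-- where q = 1 - 1 / (k + 1).
log1+_ : ℕ → ℝ
seq (log1+ k) N = ∑< N λ j → ((1ℚ ℚ.- (1/1+ k)) ℚ^.^ suc j) ℚ.* (1/1+ j)
cauchy (log1+ k) = Log.x-cauchy k

IsEulerConstant : ℝ → Set
IsEulerConstant γ = (λ k → fromℚ (∑< (suc k) 1/1+_) - log1+ k) ⟶ γ

ℕ⁺ : Set
ℕ⁺ = ∃[ n ] NonZero n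

weight : List ℕ⁺ → ℕ
weight s = ℕ.sum (List.map proj₁ s)

±1 : Sign → ℚ
±1 Sign.+ = 1ℚ
±1 Sign.- = ℚ.- 1ℚ

-- The sum over n > n₁ > ⋯ > n_d > 0, where n₁ = k + 1 is the outermost index.
eulerSum : (s : List ℕ⁺) → Vec Sign (length s) → ℕ → ℚ
eulerSum []            []      n = 1ℚ
eulerSum ((s , _) ∷ t) (σ ∷ τ) n = ∑< (n ℕ.∸ 1) λ k →
  (±1 σ ℚ^.^ suc k) ℚ.* ((1/1+ k) ℚ^.^ s) ℚ.* eulerSum t τ (suc k)

-- A polynomial is its list of coefficients, constant term first.
Polynomial : Set
Polynomial = List ℝ

eval : Polynomial → ℝ → ℝ
eval []      x = 0ℝ
eval (a ∷ P) x = a + x * eval P x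

-- The polynomials P with eulerSum s σ n = P (log n + γ) + o(1), for n = k + 1.
-- The asymptotics determine P, up to trailing zero coefficients.
record StuffleRegularization (γ : ℝ) : Set where
  field
    polynomial : (s : List ℕ⁺) → Vec Sign (length s) → Polynomial
    asymptotic : ∀ s σ →
      (λ k → fromℚ (eulerSum s σ (suc k)) - eval (polynomial s σ) (log1+ k + γ)) ⟶ 0ℝ

  ζ⁎ : (s : List ℕ⁺) → Vec Sign (length s) → ℝ
  ζ⁎ s σ = eval (polynomial s σ) 0ℝ

∑± : ∀ d → (Vec Sign d → ℝ) → ℝ
∑± zero    f = f []
∑± (suc d) f = ∑± d (λ σ → f (Sign.+ ∷ σ)) + ∑± d (λ σ → f (Sign.- ∷ σ))

-- The product of the σ_j with C (d - j); here j = toℕ i + 1.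
∏[_]_ : ∀ {C : Pred ℕ 0ℓ} → Decidable C → ∀ {d} → Vec Sign d → Sign
∏[ C? ] σ = Vector.foldr Sign._*_ Sign.+ factor
  where
  factor : Fin _ → Sign
  factor i = if does (C? (Vec.length σ ℕ.∸ suc (toℕ i))) then lookup σ i else Sign.+

symmetric : (G F : List ℕ⁺ → ℝ) → List ℕ⁺ → ℝ
symmetric G F s = sum {suc (length s)} λ i →
  (- 1ℝ) ^ weight (take (toℕ i) s) * G (List.reverse (take (toℕ i) s)) * F (drop (toℕ i) s)

module _ {γ : ℝ} (R : StuffleRegularization γ) where
  open StuffleRegularization R

  T⁎ S⁎ : List ℕ⁺ → ℝ
  T⁎ []        = 1ℝ
  T⁎ s@(_ ∷ _) = fromℚ (½ ℚ^.^ length s) *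
    ∑± (length s) (λ σ → fromℚ (±1 (∏[ 2 ∣?_ ] σ)) * ζ⁎ s σ)
  S⁎ []        = 1ℝ
  S⁎ s@(_ ∷ _) = fromℚ (½ ℚ^.^ length s) *
    ∑± (length s) (λ σ → fromℚ (±1 (∏[ (λ n → ¬? (2 ∣? n)) ] σ)) * ζ⁎ s σ)

  T⁎ˢ S⁎ˢ : List ℕ⁺ → ℝ
  T⁎ˢ s = if does (2 ∣? length s) then symmetric T⁎ T⁎ s else symmetric S⁎ T⁎ s
  S⁎ˢ s = if does (2 ∣? length s) then symmetric S⁎ S⁎ s else symmetric T⁎ S⁎ s

{-# OPTIONS --safe #-}
-- The i-th term of the sum for the reversed word is, up to exchanging the two factors, the
-- (d − i)-th term of the sum for s: both come from the same splitting s = u ++ v, with signs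
-- (-1)^|v| and (-1)^|u| whose product is (-1)^|s|. So reversal exchanges G and F in
-- symmetric G F, for arbitrary functions G and F.
module Submission where

open import Defs
open import Data.Nat using (ℕ; NonZero)
open import Data.Nat.Divisibility using (_∣_)
open import Data.List using (List; length; reverse)
open import Data.Product using (_×_)
open import Relation.Nullary using (¬_)
open import Relation.Binary.PropositionalEquality using (_≡_)

open import Data.Bool using (if_then_else_)
open import Data.Bool.Properties using (if-cong)
open import Data.Fin using (Fin; toℕ; opposite)
import Data.Fin.Permutation as Permutation
import Data.Fin.Properties as Fin
open import Data.List using ([]; _∷_; _++_; take; drop; map)
import Data.List.Properties as List
open import Data.List.Relation.Binary.Permutation.Propositional.Properties using (↭-reverse; map⁺)
import Data.Nat as ℕ
import Data.Nat.Properties as ℕ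
import Data.Nat.ListAction as ℕ using (sum)
import Data.Nat.ListAction.Properties as ℕ
open import Data.Nat.Divisibility using (_∣?_)
open import Data.Product using (_,_; proj₁)
open import Relation.Nullary.Decidable using (does; dec-true; dec-false)
open import Relation.Binary.PropositionalEquality as ≡ using (cong; cong₂; subst)
open import Algebra.Bundles using (CommutativeRing; CommutativeSemiring)
import Algebra.Properties.CommutativeSemigroup as CommutativeSemigroupProperties
import Algebra.Properties.Ring as RingProperties
import Algebra.Properties.Semiring.Exp as Exp
import Algebra.Properties.Semiring.Sum as Sum
import Relation.Binary.Reasoning.Setoid as SetoidReasoning

private
  module 𝓡 where
    open CommutativeRing ℝ-commutativeRing public
    open RingProperties ring public using (-1*x≈-x; -‿involutive)
    open Exp semiring public using (^-homo-*)
    open Sum semiring public using (sum-cong-≋; sum-permute; *-distribˡ-sum)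
    open CommutativeSemigroupProperties (CommutativeSemiring.*-commutativeSemigroup commutativeSemiring) public
      using (interchange)

module _ {A : Set} where

  take-length-++ : ∀ (xs ys : List A) → take (length xs) (xs ++ ys) ≡ xs
  take-length-++ []       ys = ≡.refl
  take-length-++ (x ∷ xs) ys = cong (x ∷_) (take-length-++ xs ys)

  drop-length-++ : ∀ (xs ys : List A) → drop (length xs) (xs ++ ys) ≡ ys
  drop-length-++ []       ys = ≡.refl
  drop-length-++ (x ∷ xs) ys = drop-length-++ xs ys

  reverse-split : ∀ k (xs : List A) → reverse xs ≡ reverse (drop k xs) ++ reverse (take k xs)
  reverse-split k xs = ≡.trans
    (cong reverse (≡.sym (List.take++drop≡id k xs)))
    (List.reverse-++ (take k xs) (drop k xs))

  length-reverse-drop : ∀ k (xs : List A) → length (reverse (drop k xs)) ≡ length xs ℕ.∸ k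
  length-reverse-drop k xs = ≡.trans (List.length-reverse (drop k xs)) (List.length-drop k xs)

  -- By `reverse-split`, `reverse (drop k xs)` is the initial block of `reverse xs`, and its length
  -- is `length xs ∸ k`. Truncated subtraction is the right length also for `k` beyond the end,
  -- where both sides are empty.
  take-reverse : ∀ k (xs : List A) → take (length xs ℕ.∸ k) (reverse xs) ≡ reverse (drop k xs)
  take-reverse k xs = ≡.trans
    (cong₂ take (≡.sym (length-reverse-drop k xs)) (reverse-split k xs))
    (take-length-++ (reverse (drop k xs)) (reverse (take k xs)))

  drop-reverse : ∀ k (xs : List A) → drop (length xs ℕ.∸ k) (reverse xs) ≡ reverse (take k xs)
  drop-reverse k xs = ≡.trans
    (cong₂ drop (≡.sym (length-reverse-drop k xs)) (reverse-split k xs))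
    (drop-length-++ (reverse (drop k xs)) (reverse (take k xs)))

weight-++ : ∀ s t → weight (s ++ t) ≡ weight s ℕ.+ weight t
weight-++ s t = ≡.trans
  (cong ℕ.sum (List.map-++ proj₁ s t))
  (ℕ.sum-++ (map proj₁ s) (map proj₁ t))

weight-reverse : ∀ s → weight (reverse s) ≡ weight s
weight-reverse s = ℕ.sum-↭ (map⁺ proj₁ (↭-reverse s))

sgn : ℕ → ℝ
sgn n = (- 1ℝ) ^ n

-- A sign is its own inverse. This stands in for division when a sign is moved from one side of an
-- identity to the other.
sgn-involutive : ∀ n → sgn n * sgn n ≃ 1ℝ
sgn-involutive ℕ.zero    = 𝓡.*-identityˡ 1ℝ
sgn-involutive (ℕ.suc n) = begin
  (- 1ℝ * sgn n) * (- 1ℝ * sgn n)  ≈⟨ 𝓡.interchange (- 1ℝ) (sgn n) (- 1ℝ) (sgn n) ⟩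
  (- 1ℝ * - 1ℝ) * (sgn n * sgn n)  ≈⟨ 𝓡.*-cong -1*-1≃1 (sgn-involutive n) ⟩
  1ℝ * 1ℝ                          ≈⟨ 𝓡.*-identityˡ 1ℝ ⟩
  1ℝ                               ∎
  where
  open SetoidReasoning 𝓡.setoid
  -1*-1≃1 : - 1ℝ * - 1ℝ ≃ 1ℝ
  -1*-1≃1 = 𝓡.trans (𝓡.-1*x≈-x (- 1ℝ)) (𝓡.-‿involutive 1ℝ)

-- The summand of `symmetric G F` as a function of the two pieces instead of the index. In this form
-- reversal of the word acts by sending `(u , v)` to `(reverse v , reverse u)`.
splitTerm : (G F : List ℕ⁺ → ℝ) (u v : List ℕ⁺) → ℝ
splitTerm G F u v = sgn (weight u) * G (reverse u) * F v

-- The first piece is reversed a second time inside the term, so `G` receives `v` itself and `F`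
-- receives `reverse u`. Up to order these are the two factors of `splitTerm F G u v`.
splitTerm-reverse : ∀ G F u v →
  splitTerm G F (reverse v) (reverse u) ≃ sgn (weight (u ++ v)) * splitTerm F G u v
splitTerm-reverse G F u v = begin
  sgn (weight (reverse v)) * G (reverse (reverse v)) * F (reverse u)
    ≡⟨ cong₂ (λ n w → sgn n * G w * F (reverse u)) (weight-reverse v) (List.reverse-involutive v) ⟩
  sgn (weight v) * G v * F (reverse u)
    ≈⟨ 𝓡.*-assoc (sgn (weight v)) (G v) (F (reverse u)) ⟩
  sgn (weight v) * (G v * F (reverse u))
    ≈⟨ 𝓡.*-cong sgn-v (𝓡.*-comm (G v) (F (reverse u))) ⟩
  (sgn (weight (u ++ v)) * sgn (weight u)) * (F (reverse u) * G v)
    ≈⟨ 𝓡.*-assoc (sgn (weight (u ++ v))) (sgn (weight u)) (F (reverse u) * G v) ⟩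
  sgn (weight (u ++ v)) * (sgn (weight u) * (F (reverse u) * G v))
    ≈⟨ 𝓡.*-congˡ (𝓡.*-assoc (sgn (weight u)) (F (reverse u)) (G v)) ⟨
  sgn (weight (u ++ v)) * splitTerm F G u v ∎
  where
  open SetoidReasoning 𝓡.setoid
  -- Multiplying by the square of `sgn (weight u)` supplies the factor that completes `weight v` to
  -- the full weight and leaves one `sgn (weight u)` over.
  sgn-v : sgn (weight v) ≃ sgn (weight (u ++ v)) * sgn (weight u)
  sgn-v = begin
    sgn (weight v)
      ≈⟨ 𝓡.*-identityʳ (sgn (weight v)) ⟨
    sgn (weight v) * 1ℝ
      ≈⟨ 𝓡.*-congˡ (sgn-involutive (weight u)) ⟨
    sgn (weight v) * (sgn (weight u) * sgn (weight u))
      ≈⟨ 𝓡.*-assoc (sgn (weight v)) (sgn (weight u)) (sgn (weight u)) ⟨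
    (sgn (weight v) * sgn (weight u)) * sgn (weight u)
      ≈⟨ 𝓡.*-congʳ (𝓡.*-comm (sgn (weight v)) (sgn (weight u))) ⟩
    (sgn (weight u) * sgn (weight v)) * sgn (weight u)
      ≈⟨ 𝓡.*-congʳ (𝓡.^-homo-* (- 1ℝ) (weight u) (weight v)) ⟨
    sgn (weight u ℕ.+ weight v) * sgn (weight u)
      ≡⟨ cong (λ n → sgn n * sgn (weight u)) (weight-++ u v) ⟨
    sgn (weight (u ++ v)) * sgn (weight u) ∎

symmetric-reverse : ∀ G F s → symmetric G F (reverse s) ≃ sgn (weight s) * symmetric F G s
symmetric-reverse G F s = begin
  symmetric G F (reverse s)
    -- Only the number of summands depends on `length (reverse s)`. Since `term` takes a natural
    -- number, the length can be rewritten without transporting indices in `Fin`.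
    ≡⟨ cong (λ n → sum {ℕ.suc n} λ i → term (toℕ i)) (List.length-reverse s) ⟩
  sum {ℕ.suc d} (λ i → term (toℕ i))
    ≈⟨ 𝓡.sum-permute {ℕ.suc d} (λ i → term (toℕ i)) Permutation.reverse ⟩
  sum {ℕ.suc d} (λ i → term (toℕ (opposite i)))
    ≈⟨ 𝓡.sum-cong-≋ {ℕ.suc d} term-opposite ⟩
  sum {ℕ.suc d} (λ i → sgn (weight s) * splitTerm F G (take (toℕ i) s) (drop (toℕ i) s))
    ≈⟨ 𝓡.*-distribˡ-sum {ℕ.suc d} (sgn (weight s)) (λ i → splitTerm F G (take (toℕ i) s) (drop (toℕ i) s)) ⟨
  sgn (weight s) * symmetric F G s ∎
  where
  open SetoidReasoning 𝓡.setoid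
  d : ℕ
  d = length s
  term : ℕ → ℝ
  term k = splitTerm G F (take k (reverse s)) (drop k (reverse s))
  term-opposite : ∀ (i : Fin (ℕ.suc d)) → term (toℕ (opposite i)) ≃
    sgn (weight s) * splitTerm F G (take (toℕ i) s) (drop (toℕ i) s)
  term-opposite i = begin
    term (toℕ (opposite i))
      -- The index runs over `Fin (suc d)`, so the opposite of `i` has value `suc d ∸ suc k`, which
      -- reduces to `d ∸ k`.
      ≡⟨ cong term (Fin.opposite-prop i) ⟩
    term (d ℕ.∸ k)
      ≡⟨ cong₂ (splitTerm G F) (take-reverse k s) (drop-reverse k s) ⟩
    splitTerm G F (reverse (drop k s)) (reverse (take k s))
      ≈⟨ splitTerm-reverse G F (take k s) (drop k s) ⟩
    sgn (weight (take k s ++ drop k s)) * splitTerm F G (take k s) (drop k s)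
      ≡⟨ cong (λ t → sgn (weight t) * splitTerm F G (take k s) (drop k s)) (List.take++drop≡id k s) ⟩
    sgn (weight s) * splitTerm F G (take k s) (drop k s) ∎
    where
    k : ℕ
    k = toℕ i

proposition2p7 : (γ : ℝ) → IsEulerConstant γ → (R : StuffleRegularization γ) →
    (d : ℕ) → .{{_ : NonZero d}} → (s : List ℕ⁺) → length s ≡ d →
    (2 ∣ d →
    (T⁎ˢ R (reverse s) ≃ (- 1ℝ) ^ weight s * T⁎ˢ R s) ×
    (S⁎ˢ R (reverse s) ≃ (- 1ℝ) ^ weight s * S⁎ˢ R s)) ×
    (¬ 2 ∣ d →
    (T⁎ˢ R (reverse s) ≃ (- 1ℝ) ^ weight s * S⁎ˢ R s) ×
    (S⁎ˢ R (reverse s) ≃ (- 1ℝ) ^ weight s * T⁎ˢ R s))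
proposition2p7 γ _ R _ s ≡.refl =
  -- The parity test on the left-hand side concerns `length (reverse s)`, hence the transported copy
  -- of the hypothesis. For even length both arguments of `symmetric` agree, so exchanging them
  -- changes nothing.
  (λ 2∣d → let 2∣d′ = subst (2 ∣_) (≡.sym (List.length-reverse s)) 2∣d in
    reverse-≃ {T⁎ R} {T⁎ R} (if-true 2∣d′) (if-true 2∣d) ,
    reverse-≃ {S⁎ R} {S⁎ R} (if-true 2∣d′) (if-true 2∣d)) ,
  -- For odd length the arguments differ, and their exchange turns `symmetric S⁎ T⁎` into
  -- `symmetric T⁎ S⁎`, that is, `T⁎ˢ` into `S⁎ˢ`, and conversely.
  (λ 2∤d → let 2∤d′ = subst (λ n → ¬ 2 ∣ n) (≡.sym (List.length-reverse s)) 2∤d in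
    reverse-≃ {S⁎ R} {T⁎ R} (if-false 2∤d′) (if-false 2∤d) ,
    reverse-≃ {T⁎ R} {S⁎ R} (if-false 2∤d′) (if-false 2∤d))
  where
  if-true : ∀ {n} {x y : ℝ} → 2 ∣ n → (if does (2 ∣? n) then x else y) ≡ x
  if-true {n} 2∣n = if-cong (dec-true (2 ∣? n) 2∣n)

  if-false : ∀ {n} {x y : ℝ} → ¬ 2 ∣ n → (if does (2 ∣? n) then x else y) ≡ y
  if-false {n} 2∤n = if-cong (dec-false (2 ∣? n) 2∤n)

  -- The selected `if` branches enter as equations for `x` and `y`, so that one argument serves both
  -- parities.
  reverse-≃ : ∀ {G F x y} → x ≡ symmetric G F (reverse s) → y ≡ symmetric F G s →
              x ≃ (- 1ℝ) ^ weight s * y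
  reverse-≃ {G} {F} ≡.refl ≡.refl = symmetric-reverse G F s
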